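{- Let $a,b$ be non-zero real numbers and let $(j_n)_{n\ge 0}$ be the bi-periodic Jacobsthal sequence associated with $a,b$. Then for every positive integer $n$, $$2\left(\frac{b}{a}\right)^{2\varepsilon(n)} j_{n-1}j_{n+1}-2\frac{b}{a}\,j_n^2=2^n\left(-\frac{b}{a}\right)^{\varepsilon(n)},$$ which can be simplified as $$\left(\frac{b}{a}\right)^{\varepsilon(n)} j_{n-1}j_{n+1}-\left(\frac{b}{a}\right)^{1-\varepsilon(n)} j_n^2=(-1)^{\varepsilon(n)}2^{n-1}.$$
   Context: Fix non-zero real numbers $a,b$. The parity function is $\varepsilon(n)=0$ if $n$ is even and $\varepsilon(n)=1$ if $n$ is odd. The bi-periodic Jacobsthal sequence is defined by $j_0=0$, $j_1=1$, and for $n\ge 2$: $j_n=aj_{n-1}+2j_{n-2}$ if $n$ is even, $j_n=bj_{n-1}+2j_{n-2}$ if $n$ is odd. -}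

module Defs where

open import Level using (0ℓ)
open import Data.Nat.Base as ℕ using (ℕ; suc; parity)
import Data.Nat.Properties as ℕ
open import Data.Parity.Base using (Parity; 0ℙ; 1ℙ)
open import Data.Product.Base using (∃-syntax; _×_; _,_)
open import Data.Sum.Base using (_⊎_; inj₁; inj₂)
open import Data.Rational.Base as ℚ using (ℚ; 0ℚ; 1ℚ; ½; ∣_∣; 1/_)
import Data.Rational.Properties as ℚ
open import Data.Rational.Solver using (module +-*-Solver)
open import Relation.Nullary using (¬_; yes; no; contradiction)
open import Relation.Binary.PropositionalEquality.Core
  using (_≡_; refl; sym; trans; cong; cong₂; subst; subst₂)
open import Algebra.Bundles using (CommutativeRing)
open import Algebra.Apartness.Bundles using (HeytingField)

-- Reals are Cauchy sequences of rationals, taken up to the setoid equality _≈_.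

record ℝ : Set where
  constructor mkℝ
  field
    seq    : ℕ → ℚ
    cauchy : ∀ ε → 0ℚ ℚ.< ε →
             ∃[ N ] ∀ m n → N ℕ.≤ m → N ℕ.≤ n → ∣ seq m ℚ.- seq n ∣ ℚ.< ε

open ℝ public

infix 4 _≈_ _#_

record _≈_ (x y : ℝ) : Set where
  constructor mk≈
  field
    close : ∀ ε → 0ℚ ℚ.< ε →
            ∃[ N ] ∀ n → N ℕ.≤ n → ∣ seq x n ℚ.- seq y n ∣ ℚ.< ε

open _≈_ public

-- The positive form of inequality: two reals are apart when they are
-- eventually separated by a positive rational.  It is tight (¬ x # y iff
-- x ≈ y), so classically it is the negation of _≈_.

record _#_ (x y : ℝ) : Set where
  constructor mk#
  field
    gap      : ℚ
    gap>0    : 0ℚ ℚ.< gap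
    from     : ℕ
    separate : ∀ n → from ℕ.≤ n → gap ℚ.≤ ∣ seq x n ℚ.- seq y n ∣

private

  record Vanishes (f : ℕ → ℕ → ℚ) : Set where
    constructor vanish
    field
      bound : ∀ ε → 0ℚ ℚ.< ε →
              ∃[ N ] ∀ m n → N ℕ.≤ m → N ℕ.≤ n → ∣ f m n ∣ ℚ.< ε

  open Vanishes

  record EventuallyBounded (f : ℕ → ℕ → ℚ) : Set where
    constructor bounded
    field
      K    : ℚ
      K>0  : 0ℚ ℚ.< K
      from : ℕ
      f≤K  : ∀ m n → from ℕ.≤ m → from ℕ.≤ n → ∣ f m n ∣ ℚ.≤ K

  record Away (f : ℕ → ℚ) : Set where
    constructor away
    field
      δ    : ℚ
      δ>0  : 0ℚ ℚ.< δ
      from : ℕ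
      δ≤f  : ∀ n → from ℕ.≤ n → δ ℚ.≤ ∣ f n ∣

  ⊔-boundˡ : ∀ {k} M N → M ℕ.⊔ N ℕ.≤ k → M ℕ.≤ k
  ⊔-boundˡ M N = ℕ.≤-trans (ℕ.m≤m⊔n M N)

  ⊔-boundʳ : ∀ {k} M N → M ℕ.⊔ N ℕ.≤ k → N ℕ.≤ k
  ⊔-boundʳ M N = ℕ.≤-trans (ℕ.m≤n⊔m M N)

  abstract

    -‿+ : ∀ a b c d → (a ℚ.- b) ℚ.+ (c ℚ.- d) ≡ (a ℚ.+ c) ℚ.- (b ℚ.+ d)
    -‿+ = solve 4 (λ a b c d → (a :- b) :+ (c :- d) := (a :+ c) :- (b :+ d)) refl
      where open +-*-Solver

    -‿* : ∀ a b c d → a ℚ.* (c ℚ.- d) ℚ.+ d ℚ.* (a ℚ.- b) ≡ a ℚ.* c ℚ.- b ℚ.* d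
    -‿* = solve 4 (λ a b c d → a :* (c :- d) :+ d :* (a :- b) := a :* c :- b :* d) refl
      where open +-*-Solver

    -‿cancel : ∀ a b → (a ℚ.- b) ℚ.+ b ≡ a
    -‿cancel = solve 2 (λ a b → (a :- b) :+ b := a) refl
      where open +-*-Solver

    -‿telescope : ∀ a b c → (a ℚ.- b) ℚ.+ (b ℚ.- c) ≡ a ℚ.- c
    -‿telescope = solve 3 (λ a b c → (a :- b) :+ (b :- c) := a :- c) refl
      where open +-*-Solver

    -‿flip : ∀ a b → ℚ.- (a ℚ.- b) ≡ b ℚ.- a
    -‿flip = solve 2 (λ a b → :- (a :- b) := b :- a) refl
      where open +-*-Solver

    -‿zero : ∀ a → a ℚ.- 0ℚ ≡ a
    -‿zero = ℚ.+-identityʳ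

    -‿recip : ∀ p q r s → r ℚ.* (s ℚ.* (ℚ.- (p ℚ.- q))) ≡ (q ℚ.* s) ℚ.* r ℚ.- (p ℚ.* r) ℚ.* s
    -‿recip = solve 4 (λ p q r s → r :* (s :* (:- (p :- q))) := (q :* s) :* r :- (p :* r) :* s) refl
      where open +-*-Solver

    *-swap : ∀ k h r → k ℚ.* (h ℚ.* r) ≡ h ℚ.* (k ℚ.* r)
    *-swap = solve 3 (λ k h r → k :* (h :* r) := h :* (k :* r)) refl
      where open +-*-Solver

    *-pos : ∀ p q → 0ℚ ℚ.< p → 0ℚ ℚ.< q → 0ℚ ℚ.< p ℚ.* q
    *-pos p q p>0 q>0 =
      ℚ.positive⁻¹ (p ℚ.* q) {{ℚ.pos*pos⇒pos p {{ℚ.positive p>0}} q {{ℚ.positive q>0}}}}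

    half : ℚ → ℚ
    half ε = ½ ℚ.* ε

    half>0 : ∀ {ε} → 0ℚ ℚ.< ε → 0ℚ ℚ.< half ε
    half>0 {ε} = *-pos ½ ε (ℚ.positive⁻¹ ½)

    halves : ∀ ε → half ε ℚ.+ half ε ≡ ε
    halves ε = trans (sym (ℚ.*-distribʳ-+ ε ½ ½)) (ℚ.*-identityˡ ε)

    half≤ : ∀ {ε} → 0ℚ ℚ.< ε → half ε ℚ.≤ ε
    half≤ {ε} ε>0 = subst₂ ℚ._≤_ (ℚ.+-identityʳ (half ε)) (halves ε)
      (ℚ.+-monoʳ-≤ (half ε) (ℚ.<⇒≤ (half>0 ε>0)))

    *-half : ∀ k ε → k ℚ.* half ε ≡ half (k ℚ.* ε)
    *-half k ε = *-swap k ½ ε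

    1>0 : 0ℚ ℚ.< 1ℚ
    1>0 = ℚ.positive⁻¹ 1ℚ

    pos⇒≢0 : ∀ {p} → 0ℚ ℚ.< p → ¬ p ≡ 0ℚ
    pos⇒≢0 p>0 p≡0 = ℚ.<-irrefl (sym p≡0) p>0

    away⇒≢0 : ∀ p δ → 0ℚ ℚ.< δ → δ ℚ.≤ ∣ p ∣ → ¬ p ≡ 0ℚ
    away⇒≢0 p δ δ>0 δ≤p refl = ℚ.<-irrefl refl (ℚ.<-≤-trans δ>0 δ≤p)

    ∣∣-mono-* : ∀ p q K ε → 0ℚ ℚ.< K → ∣ p ∣ ℚ.≤ K → ∣ q ∣ ℚ.< ε →
                ∣ p ℚ.* q ∣ ℚ.< K ℚ.* ε
    ∣∣-mono-* p q K ε K>0 p≤K q<ε = begin-strict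
      ∣ p ℚ.* q ∣      ≡⟨ ℚ.∣p*q∣≡∣p∣*∣q∣ p q ⟩
      ∣ p ∣ ℚ.* ∣ q ∣  ≤⟨ ℚ.*-monoʳ-≤-nonNeg ∣ q ∣ {{ℚ.∣-∣-nonNeg q}} p≤K ⟩
      K ℚ.* ∣ q ∣      <⟨ ℚ.*-monoʳ-<-pos K {{ℚ.positive K>0}} q<ε ⟩
      K ℚ.* ε          ∎
      where open ℚ.≤-Reasoning

    triangle : ∀ p q → ∣ p ∣ ℚ.≤ ∣ p ℚ.- q ∣ ℚ.+ ∣ q ∣
    triangle p q = subst (ℚ._≤ ∣ p ℚ.- q ∣ ℚ.+ ∣ q ∣)
      (cong ∣_∣ (-‿cancel p q)) (ℚ.∣p+q∣≤∣p∣+∣q∣ (p ℚ.- q) q)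

    triangle₃ : ∀ p q r → ∣ p ℚ.- r ∣ ℚ.≤ ∣ p ℚ.- q ∣ ℚ.+ ∣ q ℚ.- r ∣
    triangle₃ p q r = subst (λ t → ∣ t ∣ ℚ.≤ ∣ p ℚ.- q ∣ ℚ.+ ∣ q ℚ.- r ∣)
      (-‿telescope p q r) (ℚ.∣p+q∣≤∣p∣+∣q∣ (p ℚ.- q) (q ℚ.- r))

    ∣-∣-sym : ∀ p q → ∣ p ℚ.- q ∣ ≡ ∣ q ℚ.- p ∣
    ∣-∣-sym p q = trans (sym (ℚ.∣-p∣≡∣p∣ (p ℚ.- q))) (cong ∣_∣ (-‿flip p q))

    ≤-cancel : ∀ p q r s → q ℚ.+ p ℚ.≤ s ℚ.+ r → s ℚ.≤ q → p ℚ.≤ r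
    ≤-cancel p q r s le s≤q = ℚ.≮⇒≥ λ r<p →
      ℚ.<-irrefl refl (ℚ.<-≤-trans (ℚ.+-mono-≤-< s≤q r<p) le)

  -- The junk value 0 at 0 makes recip total, so that it acts termwise on sequences.
  recip : ℚ → ℚ
  recip p with p ℚ.≟ 0ℚ
  ... | yes _   = 0ℚ
  ... | no  p≢0 = 1/_ p {{ℚ.≢-nonZero p≢0}}

  abstract

    *-inverse : ∀ p → ¬ p ≡ 0ℚ → p ℚ.* recip p ≡ 1ℚ
    *-inverse p p≢0 with p ℚ.≟ 0ℚ
    ... | yes p≡0  = contradiction p≡0 p≢0
    ... | no  p≢0′ = ℚ.*-inverseʳ p {{ℚ.≢-nonZero p≢0′}}

    recip-pos : ∀ p → 0ℚ ℚ.< p → 0ℚ ℚ.< recip p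
    recip-pos p p>0 with p ℚ.≟ 0ℚ
    ... | yes p≡0 = contradiction p≡0 (pos⇒≢0 p>0)
    ... | no  p≢0 = ℚ.positive⁻¹ (1/_ p {{ℚ.≢-nonZero p≢0}}) {{ℚ.1/pos⇒pos p {{ℚ.positive p>0}}}}

    recip-bound′ : ∀ p r δ e → 0ℚ ℚ.< e → p ℚ.* r ≡ 1ℚ → δ ℚ.* e ≡ 1ℚ → δ ℚ.≤ ∣ p ∣ → ∣ r ∣ ℚ.≤ e
    recip-bound′ p r δ e e>0 pr≡1 δe≡1 δ≤p = begin
      ∣ r ∣                    ≡⟨ ℚ.*-identityʳ ∣ r ∣ ⟨
      ∣ r ∣ ℚ.* 1ℚ             ≡⟨ cong (∣ r ∣ ℚ.*_) (trans (ℚ.*-comm e δ) δe≡1) ⟨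
      ∣ r ∣ ℚ.* (e ℚ.* δ)      ≡⟨ *-swap ∣ r ∣ e δ ⟩
      e ℚ.* (∣ r ∣ ℚ.* δ)      ≡⟨ cong (e ℚ.*_) (ℚ.*-comm ∣ r ∣ δ) ⟩
      e ℚ.* (δ ℚ.* ∣ r ∣)      ≤⟨ ℚ.*-monoˡ-≤-nonNeg e {{ℚ.pos⇒nonNeg e {{ℚ.positive e>0}}}}
                                   (ℚ.*-monoʳ-≤-nonNeg ∣ r ∣ {{ℚ.∣-∣-nonNeg r}} δ≤p) ⟩
      e ℚ.* (∣ p ∣ ℚ.* ∣ r ∣)  ≡⟨ cong (e ℚ.*_) (ℚ.∣p*q∣≡∣p∣*∣q∣ p r) ⟨
      e ℚ.* ∣ p ℚ.* r ∣        ≡⟨ cong (λ t → e ℚ.* ∣ t ∣) pr≡1 ⟩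
      e ℚ.* 1ℚ                 ≡⟨ ℚ.*-identityʳ e ⟩
      e                        ∎
      where open ℚ.≤-Reasoning

    recip-bound : ∀ p δ → 0ℚ ℚ.< δ → δ ℚ.≤ ∣ p ∣ → ∣ recip p ∣ ℚ.≤ recip δ
    recip-bound p δ δ>0 δ≤p = recip-bound′ p (recip p) δ (recip δ) (recip-pos δ δ>0)
      (*-inverse p (away⇒≢0 p δ δ>0 δ≤p)) (*-inverse δ (pos⇒≢0 δ>0)) δ≤p

    recip-difference : ∀ p q r s → p ℚ.* r ≡ 1ℚ → q ℚ.* s ≡ 1ℚ →
                       r ℚ.* (s ℚ.* (ℚ.- (p ℚ.- q))) ≡ r ℚ.- s
    recip-difference p q r s pr≡1 qs≡1 =
      trans (-‿recip p q r s)
        (trans (cong₂ (λ t u → t ℚ.* r ℚ.- u ℚ.* s) qs≡1 pr≡1)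
          (cong₂ ℚ._-_ (ℚ.*-identityˡ r) (ℚ.*-identityˡ s)))

    scale : ∀ K ε → 0ℚ ℚ.< K → K ℚ.* (recip K ℚ.* ε) ≡ ε
    scale K ε K>0 = trans (sym (ℚ.*-assoc K (recip K) ε))
      (trans (cong (ℚ._* ε) (*-inverse K (pos⇒≢0 K>0))) (ℚ.*-identityˡ ε))

    vanishes-0 : ∀ {f} → (∀ m n → f m n ≡ 0ℚ) → Vanishes f
    vanishes-0 f≡0 = vanish λ ε ε>0 →
      0 , λ m n _ _ → subst (λ t → ∣ t ∣ ℚ.< ε) (sym (f≡0 m n)) ε>0

    vanishes-resp : ∀ {f g} N → (∀ m n → N ℕ.≤ m → N ℕ.≤ n → f m n ≡ g m n) →
                    Vanishes f → Vanishes g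
    vanishes-resp N f≡g v = vanish λ ε ε>0 → let M , p = bound v ε ε>0 in
      M ℕ.⊔ N , λ m n le le′ →
        subst (λ t → ∣ t ∣ ℚ.< ε) (f≡g m n (⊔-boundʳ M N le) (⊔-boundʳ M N le′))
              (p m n (⊔-boundˡ M N le) (⊔-boundˡ M N le′))

    vanishes-≡ : ∀ {f g} → (∀ m n → f m n ≡ g m n) → Vanishes f → Vanishes g
    vanishes-≡ f≡g = vanishes-resp 0 λ m n _ _ → f≡g m n

    vanishes-+ : ∀ {f g} → Vanishes f → Vanishes g →
                 Vanishes (λ m n → f m n ℚ.+ g m n)
    vanishes-+ {f} {g} vf vg = vanish λ ε ε>0 →
      let M , p = bound vf (half ε) (half>0 ε>0)
          N , q = bound vg (half ε) (half>0 ε>0)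
      in M ℕ.⊔ N , λ m n le le′ →
        ℚ.≤-<-trans (ℚ.∣p+q∣≤∣p∣+∣q∣ (f m n) (g m n))
          (subst (∣ f m n ∣ ℚ.+ ∣ g m n ∣ ℚ.<_) (halves ε)
            (ℚ.+-mono-< (p m n (⊔-boundˡ M N le) (⊔-boundˡ M N le′))
                        (q m n (⊔-boundʳ M N le) (⊔-boundʳ M N le′))))

    vanishes-neg : ∀ {f} → Vanishes f → Vanishes (λ m n → ℚ.- f m n)
    vanishes-neg {f} v = vanish λ ε ε>0 → let N , p = bound v ε ε>0 in
      N , λ m n le le′ → subst (ℚ._< ε) (sym (ℚ.∣-p∣≡∣p∣ (f m n))) (p m n le le′)

    vanishes-* : ∀ {f g} → EventuallyBounded f → Vanishes g →
                 Vanishes (λ m n → f m n ℚ.* g m n)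
    vanishes-* {f} {g} (bounded K K>0 M f≤K) v = vanish λ ε ε>0 →
      let N , q = bound v (recip K ℚ.* ε) (*-pos (recip K) ε (recip-pos K K>0) ε>0)
      in M ℕ.⊔ N , λ m n le le′ →
        subst (∣ f m n ℚ.* g m n ∣ ℚ.<_) (scale K ε K>0)
          (∣∣-mono-* (f m n) (g m n) K (recip K ℚ.* ε) K>0
            (f≤K m n (⊔-boundˡ M N le) (⊔-boundˡ M N le′))
            (q m n (⊔-boundʳ M N le) (⊔-boundʳ M N le′)))

    cauchy′ : (x : ℝ) → Vanishes (λ m n → seq x m ℚ.- seq x n)
    cauchy′ x = vanish (cauchy x)

    boundedˡ : (x : ℝ) → EventuallyBounded (λ m _ → seq x m)
    boundedˡ x = let N , c = cauchy x 1ℚ 1>0 in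
      bounded (1ℚ ℚ.+ ∣ seq x N ∣) (ℚ.+-mono-<-≤ 1>0 (ℚ.0≤∣p∣ (seq x N))) N λ m _ le _ →
        ℚ.≤-trans (triangle (seq x m) (seq x N))
                  (ℚ.+-monoˡ-≤ ∣ seq x N ∣ (ℚ.<⇒≤ (c m N le ℕ.≤-refl)))

    boundedʳ : (x : ℝ) → EventuallyBounded (λ _ n → seq x n)
    boundedʳ x = let bounded K K>0 N b = boundedˡ x in
      bounded K K>0 N λ m n le le′ → b n m le′ le

    to-≈ : ∀ {x y} → Vanishes (λ m _ → seq x m ℚ.- seq y m) → x ≈ y
    to-≈ v = mk≈ λ ε ε>0 → let N , p = bound v ε ε>0 in N , λ n le → p n n le le

    from-≈ : ∀ {x y} → x ≈ y → Vanishes (λ m _ → seq x m ℚ.- seq y m)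
    from-≈ x≈y = vanish λ ε ε>0 → let N , p = close x≈y ε ε>0 in N , λ m _ le _ → p m le

    ≡⇒≈ : ∀ {x y} → (∀ n → seq x n ≡ seq y n) → x ≈ y
    ≡⇒≈ {x} {y} eq = to-≈ (vanishes-0 λ m _ →
      trans (cong (ℚ._- seq y m) (eq m)) (ℚ.+-inverseʳ (seq y m)))

    const-cauchy : (q : ℚ) → Vanishes (λ _ _ → q ℚ.- q)
    const-cauchy q = vanishes-0 λ _ _ → ℚ.+-inverseʳ q

    +-cauchy : (x y : ℝ) → Vanishes (λ m n → (seq x m ℚ.+ seq y m) ℚ.- (seq x n ℚ.+ seq y n))
    +-cauchy x y =
      vanishes-≡ (λ m n → -‿+ (seq x m) (seq x n) (seq y m) (seq y n))
                 (vanishes-+ (cauchy′ x) (cauchy′ y))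

    neg-cauchy : (x : ℝ) → Vanishes (λ m n → (ℚ.- seq x m) ℚ.- (ℚ.- seq x n))
    neg-cauchy x =
      vanishes-≡ (λ m n → ℚ.neg-distrib-+ (seq x m) (ℚ.- seq x n)) (vanishes-neg (cauchy′ x))

    *-cauchy : (x y : ℝ) → Vanishes (λ m n → seq x m ℚ.* seq y m ℚ.- seq x n ℚ.* seq y n)
    *-cauchy x y =
      vanishes-≡ (λ m n → -‿* (seq x m) (seq x n) (seq y m) (seq y n))
                 (vanishes-+ (vanishes-* (boundedˡ x) (cauchy′ y))
                             (vanishes-* (boundedʳ y) (cauchy′ x)))

fromℚ : ℚ → ℝ
fromℚ q = mkℝ (λ _ → q) (bound (const-cauchy q))

0ℝ 1ℝ : ℝ
0ℝ = fromℚ 0ℚ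
1ℝ = fromℚ 1ℚ

infix  8 -_
infixl 7 _*_
infixl 6 _+_ _-_

_+_ : ℝ → ℝ → ℝ
x + y = mkℝ (λ n → seq x n ℚ.+ seq y n) (bound (+-cauchy x y))

-_ : ℝ → ℝ
- x = mkℝ (λ n → ℚ.- seq x n) (bound (neg-cauchy x))

_-_ : ℝ → ℝ → ℝ
x - y = x + (- y)

_*_ : ℝ → ℝ → ℝ
x * y = mkℝ (λ n → seq x n ℚ.* seq y n) (bound (*-cauchy x y))

2ℝ : ℝ
2ℝ = 1ℝ + 1ℝ

private abstract

  #0⇒away : ∀ {x} → x # 0ℝ → Away (seq x)
  #0⇒away {x} (mk# δ δ>0 N sep) = away δ δ>0 N λ n le →
    subst (λ t → δ ℚ.≤ ∣ t ∣) (-‿zero (seq x n)) (sep n le)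

  away⇒#0 : ∀ {x} → Away (seq x) → x # 0ℝ
  away⇒#0 {x} (away δ δ>0 N sep) = mk# δ δ>0 N λ n le →
    subst (λ t → δ ℚ.≤ ∣ t ∣) (sym (-‿zero (seq x n))) (sep n le)

  inverse-cauchy : (x : ℝ) → Away (seq x) → Vanishes (λ m n → recip (seq x m) ℚ.- recip (seq x n))
  inverse-cauchy x (away δ δ>0 N sep) =
    vanishes-resp N
      (λ m n le le′ → recip-difference (seq x m) (seq x n) (recip (seq x m)) (recip (seq x n))
        (*-inverse (seq x m) (away⇒≢0 (seq x m) δ δ>0 (sep m le)))
        (*-inverse (seq x n) (away⇒≢0 (seq x n) δ δ>0 (sep n le′))))
      (vanishes-* (bounded (recip δ) (recip-pos δ δ>0) N λ m _ le _ → recip-bound (seq x m) δ δ>0 (sep m le))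
        (vanishes-* (bounded (recip δ) (recip-pos δ δ>0) N λ _ n _ le → recip-bound (seq x n) δ δ>0 (sep n le))
          (vanishes-neg (cauchy′ x))))

-- The finitely many zero terms of a sequence x with x # 0ℝ get reciprocal 0.

inverse : (x : ℝ) → x # 0ℝ → ℝ
inverse x x#0 = mkℝ (λ n → recip (seq x n)) (bound (inverse-cauchy x (#0⇒away x#0)))

infixl 7 _/_⟨_⟩

_/_⟨_⟩ : (x y : ℝ) → y # 0ℝ → ℝ
x / y ⟨ y#0 ⟩ = x * inverse y y#0

private abstract

  ≈-refl : ∀ {x} → x ≈ x
  ≈-refl {x} = ≡⇒≈ {x} {x} λ _ → refl

  ≈-sym : ∀ {x y} → x ≈ y → y ≈ x
  ≈-sym {x} {y} x≈y = to-≈ {y} {x}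
    (vanishes-≡ (λ m _ → -‿flip (seq x m) (seq y m)) (vanishes-neg (from-≈ x≈y)))

  ≈-trans : ∀ {x y z} → x ≈ y → y ≈ z → x ≈ z
  ≈-trans {x} {y} {z} x≈y y≈z = to-≈ {x} {z}
    (vanishes-≡ (λ m _ → -‿telescope (seq x m) (seq y m) (seq z m))
                (vanishes-+ (from-≈ x≈y) (from-≈ y≈z)))

  +-cong : ∀ {x y u v} → x ≈ y → u ≈ v → x + u ≈ y + v
  +-cong {x} {y} {u} {v} x≈y u≈v = to-≈ {x + u} {y + v}
    (vanishes-≡ (λ m _ → -‿+ (seq x m) (seq y m) (seq u m) (seq v m))
                (vanishes-+ (from-≈ x≈y) (from-≈ u≈v)))

  neg-cong : ∀ {x y} → x ≈ y → - x ≈ - y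
  neg-cong {x} {y} x≈y = to-≈ { - x} { - y}
    (vanishes-≡ (λ m _ → ℚ.neg-distrib-+ (seq x m) (ℚ.- seq y m)) (vanishes-neg (from-≈ x≈y)))

  *-cong : ∀ {x y u v} → x ≈ y → u ≈ v → x * u ≈ y * v
  *-cong {x} {y} {u} {v} x≈y u≈v = to-≈ {x * u} {y * v}
    (vanishes-≡ (λ m _ → -‿* (seq x m) (seq y m) (seq u m) (seq v m))
                (vanishes-+ (vanishes-* (boundedˡ x) (from-≈ u≈v))
                            (vanishes-* (boundedˡ v) (from-≈ x≈y))))

  +-assoc : ∀ x y z → (x + y) + z ≈ x + (y + z)
  +-assoc x y z = ≡⇒≈ {(x + y) + z} {x + (y + z)} λ n → ℚ.+-assoc (seq x n) (seq y n) (seq z n)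

  +-comm : ∀ x y → x + y ≈ y + x
  +-comm x y = ≡⇒≈ {x + y} {y + x} λ n → ℚ.+-comm (seq x n) (seq y n)

  +-identityˡ : ∀ x → 0ℝ + x ≈ x
  +-identityˡ x = ≡⇒≈ {0ℝ + x} {x} λ n → ℚ.+-identityˡ (seq x n)

  +-inverseʳ : ∀ x → x + - x ≈ 0ℝ
  +-inverseʳ x = ≡⇒≈ {x + - x} {0ℝ} λ n → ℚ.+-inverseʳ (seq x n)

  *-assoc : ∀ x y z → (x * y) * z ≈ x * (y * z)
  *-assoc x y z = ≡⇒≈ {(x * y) * z} {x * (y * z)} λ n → ℚ.*-assoc (seq x n) (seq y n) (seq z n)

  *-comm : ∀ x y → x * y ≈ y * x
  *-comm x y = ≡⇒≈ {x * y} {y * x} λ n → ℚ.*-comm (seq x n) (seq y n)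

  *-identityˡ : ∀ x → 1ℝ * x ≈ x
  *-identityˡ x = ≡⇒≈ {1ℝ * x} {x} λ n → ℚ.*-identityˡ (seq x n)

  *-distribˡ-+ : ∀ x y z → x * (y + z) ≈ x * y + x * z
  *-distribˡ-+ x y z = ≡⇒≈ {x * (y + z)} {x * y + x * z} λ n → ℚ.*-distribˡ-+ (seq x n) (seq y n) (seq z n)

ℝ-commutativeRing : CommutativeRing 0ℓ 0ℓ
ℝ-commutativeRing = record
  { Carrier = ℝ ; _≈_ = _≈_ ; _+_ = _+_ ; _*_ = _*_ ; -_ = -_ ; 0# = 0ℝ ; 1# = 1ℝ
  ; isCommutativeRing = record
    { isRing = record
      { +-isAbelianGroup = record
        { isGroup = record
          { isMonoid = record
            { isSemigroup = record
              { isMagma = record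
                { isEquivalence = record
                  { refl  = λ {x} → ≈-refl {x}
                  ; sym   = ≈-sym
                  ; trans = ≈-trans
                  }
                ; ∙-cong = +-cong
                }
              ; assoc = +-assoc
              }
            ; identity = +-identityˡ , λ x → ≈-trans (+-comm x 0ℝ) (+-identityˡ x)
            }
          ; inverse = (λ x → ≈-trans (+-comm (- x) x) (+-inverseʳ x)) , +-inverseʳ
          ; ⁻¹-cong = neg-cong
          }
        ; comm = +-comm
        }
      ; *-cong = *-cong
      ; *-assoc = *-assoc
      ; *-identity = *-identityˡ , λ x → ≈-trans (*-comm x 1ℝ) (*-identityˡ x)
      ; distrib = *-distribˡ-+ , λ x y z →
          ≈-trans (*-comm (y + z) x) (≈-trans (*-distribˡ-+ x y z) (+-cong (*-comm x y) (*-comm x z)))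
      }
    ; *-comm = *-comm
    }
  }

abstract

  inverseʳ : ∀ x (x#0 : x # 0ℝ) → x * inverse x x#0 ≈ 1ℝ
  inverseʳ x x#0 = let away δ δ>0 N sep = #0⇒away x#0 in
    to-≈ {x * inverse x x#0} {1ℝ} (vanishes-resp N
      (λ m _ le _ → sym (trans
        (cong (ℚ._- 1ℚ) (*-inverse (seq x m) (away⇒≢0 (seq x m) δ δ>0 (sep m le))))
        (ℚ.+-inverseʳ 1ℚ)))
      (vanishes-0 {λ _ _ → 0ℚ} λ _ _ → refl))

private abstract

  Small : (ℕ → ℚ) → ℚ → Set
  Small f ε = ∃[ N ] ∀ n → N ℕ.≤ n → ∣ f n ∣ ℚ.< ε

  dichotomy : ∀ x ε → 0ℚ ℚ.< ε → Small (seq x) ε ⊎ Away (seq x)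
  dichotomy x ε ε>0 = let N , c = cauchy x (half (half ε)) (half>0 (half>0 ε>0)) in go N c
    where
    open ℚ.≤-Reasoning
    go : ∀ N → (∀ m n → N ℕ.≤ m → N ℕ.≤ n → ∣ seq x m ℚ.- seq x n ∣ ℚ.< half (half ε)) →
         Small (seq x) ε ⊎ Away (seq x)
    go N c with ∣ seq x N ∣ ℚ.<? half ε
    ... | yes small = inj₁ (N , λ n N≤n → begin-strict
      ∣ seq x n ∣                                ≤⟨ triangle (seq x n) (seq x N) ⟩
      ∣ seq x n ℚ.- seq x N ∣ ℚ.+ ∣ seq x N ∣    <⟨ ℚ.+-mono-< (c n N N≤n ℕ.≤-refl) small ⟩
      half (half ε) ℚ.+ half ε                   ≤⟨ ℚ.+-monoˡ-≤ (half ε) (half≤ (half>0 ε>0)) ⟩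
      half ε ℚ.+ half ε                          ≡⟨ halves ε ⟩
      ε                                          ∎)
    ... | no big = inj₂ (away (half (half ε)) (half>0 (half>0 ε>0)) N λ n N≤n →
      ≤-cancel (half (half ε)) (half (half ε)) ∣ seq x n ∣ ∣ seq x N ℚ.- seq x n ∣
        (begin
          half (half ε) ℚ.+ half (half ε)            ≡⟨ halves (half ε) ⟩
          half ε                                     ≤⟨ ℚ.≮⇒≥ big ⟩
          ∣ seq x N ∣                                ≤⟨ triangle (seq x N) (seq x n) ⟩
          ∣ seq x N ℚ.- seq x n ∣ ℚ.+ ∣ seq x n ∣    ∎)
        (ℚ.<⇒≤ (c N n ℕ.≤-refl N≤n)))

  #⇒-#0 : ∀ {x y} → x # y → x - y # 0ℝ
  #⇒-#0 {x} {y} (mk# δ δ>0 N sep) = away⇒#0 {x - y} (away δ δ>0 N sep)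

  away⇒# : ∀ {x y} → Away (seq (x - y)) → x # y
  away⇒# (away δ δ>0 N sep) = mk# δ δ>0 N sep

  #-irrefl : ∀ {x y} → x ≈ y → ¬ x # y
  #-irrefl (mk≈ c) (mk# δ δ>0 N sep) = let M , p = c δ δ>0 in
    ℚ.<-irrefl refl (ℚ.≤-<-trans (sep (N ℕ.⊔ M) (ℕ.m≤m⊔n N M)) (p (N ℕ.⊔ M) (ℕ.m≤n⊔m N M)))

  #-sym : ∀ {x y} → x # y → y # x
  #-sym {x} {y} (mk# δ δ>0 N sep) = mk# δ δ>0 N λ n le →
    subst (δ ℚ.≤_) (∣-∣-sym (seq x n) (seq y n)) (sep n le)

  #-cotrans : ∀ {x y} → x # y → ∀ z → x # z ⊎ z # y
  #-cotrans {x} {y} (mk# δ δ>0 N sep) z = go (dichotomy (x - z) (half δ) (half>0 δ>0))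
    where
    open ℚ.≤-Reasoning
    go : Small (seq (x - z)) (half δ) ⊎ Away (seq (x - z)) → x # z ⊎ z # y
    go (inj₂ x-z#0)      = inj₁ (away⇒# x-z#0)
    go (inj₁ (M , near)) = inj₂ (mk# (half δ) (half>0 δ>0) (N ℕ.⊔ M) λ n le →
      ≤-cancel (half δ) (half δ) ∣ seq z n ℚ.- seq y n ∣ ∣ seq x n ℚ.- seq z n ∣
        (begin
          half δ ℚ.+ half δ                                      ≡⟨ halves δ ⟩
          δ                                                      ≤⟨ sep n (⊔-boundˡ N M le) ⟩
          ∣ seq x n ℚ.- seq y n ∣                                ≤⟨ triangle₃ (seq x n) (seq z n) (seq y n) ⟩
          ∣ seq x n ℚ.- seq z n ∣ ℚ.+ ∣ seq z n ℚ.- seq y n ∣    ∎)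
        (ℚ.<⇒≤ (near n (⊔-boundʳ N M le))))

  #-tight : ∀ x y → ¬ x # y → x ≈ y
  #-tight x y ¬x#y = mk≈ λ ε ε>0 → go ε (dichotomy (x - y) ε ε>0)
    where
    go : ∀ ε → Small (seq (x - y)) ε ⊎ Away (seq (x - y)) → Small (seq (x - y)) ε
    go ε (inj₁ near)  = near
    go ε (inj₂ x-y#0) = contradiction (away⇒# x-y#0) ¬x#y

  invertible⇒away : ∀ x y → x * y ≈ 1ℝ → Away (seq x)
  invertible⇒away x y xy≈1 =
    let bounded K K>0 M y≤K = boundedˡ y in
    go K K>0 M (λ n le → y≤K n n le le)
       (dichotomy x (half (recip K)) (half>0 (recip-pos K K>0))) (close xy≈1 (half 1ℚ) (half>0 1>0))
    where
    go : ∀ K → 0ℚ ℚ.< K → ∀ M → (∀ n → M ℕ.≤ n → ∣ seq y n ∣ ℚ.≤ K) →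
         Small (seq x) (half (recip K)) ⊎ Away (seq x) →
         Small (λ n → seq x n ℚ.* seq y n ℚ.- 1ℚ) (half 1ℚ) → Away (seq x)
    go K K>0 M y≤K (inj₂ x#0)         _          = x#0
    go K K>0 M y≤K (inj₁ (N , small)) (L , near) =
      contradiction (ℚ.≤-<-trans (triangle 1ℚ (p ℚ.* q)) 1<1) (ℚ.<-irrefl refl)
      where
      n : ℕ
      n = L ℕ.⊔ (M ℕ.⊔ N)
      p q : ℚ
      p = seq x n
      q = seq y n
      pq<½ : ∣ p ℚ.* q ∣ ℚ.< half 1ℚ
      pq<½ = subst₂ (λ t u → ∣ t ∣ ℚ.< u) (ℚ.*-comm q p)
        (trans (*-half K (recip K)) (cong half (*-inverse K (pos⇒≢0 K>0))))
        (∣∣-mono-* q p K (half (recip K)) K>0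
          (y≤K n (⊔-boundˡ M N (ℕ.m≤n⊔m L (M ℕ.⊔ N))))
          (small n (⊔-boundʳ M N (ℕ.m≤n⊔m L (M ℕ.⊔ N)))))
      1<1 : ∣ 1ℚ ℚ.- p ℚ.* q ∣ ℚ.+ ∣ p ℚ.* q ∣ ℚ.< 1ℚ
      1<1 = subst (∣ 1ℚ ℚ.- p ℚ.* q ∣ ℚ.+ ∣ p ℚ.* q ∣ ℚ.<_) (halves 1ℚ)
        (ℚ.+-mono-< (subst (ℚ._< half 1ℚ) (∣-∣-sym (p ℚ.* q) 1ℚ) (near n (ℕ.m≤m⊔n L (M ℕ.⊔ N)))) pq<½)

ℝ-heytingField : HeytingField 0ℓ 0ℓ 0ℓ
ℝ-heytingField = record
  { Carrier = ℝ ; _≈_ = _≈_ ; _#_ = _#_ ; _+_ = _+_ ; _*_ = _*_ ; -_ = -_ ; 0# = 0ℝ ; 1# = 1ℝ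
  ; isHeytingField = record
    { isHeytingCommutativeRing = record
      { isCommutativeRing   = CommutativeRing.isCommutativeRing ℝ-commutativeRing
      ; isApartnessRelation = record
        { irrefl = #-irrefl ; sym = #-sym ; cotrans = #-cotrans }
      ; #⇒invertible = λ {x} {y} x#y →
          let i = inverse (x - y) (#⇒-#0 x#y) ; p = inverseʳ (x - y) (#⇒-#0 x#y) in
          i , ≈-trans (*-comm i (x - y)) p , p
      ; invertible⇒# = λ {x} {y} (i , _ , p) → away⇒# (invertible⇒away (x - y) i p)
      }
    ; tight = λ x y → #-tight x y , #-irrefl
    }
  }

open import Algebra.Properties.Semiring.Exp
  (CommutativeRing.semiring ℝ-commutativeRing) public using (_^_)

bit : Parity → ℕ
bit 0ℙ = 0
bit 1ℙ = 1

ε : ℕ → ℕ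
ε n = bit (parity n)

module _ (a b : ℝ) where

  coefficient : Parity → ℝ
  coefficient 0ℙ = a
  coefficient 1ℙ = b

  jacobsthal : ℕ → ℝ
  jacobsthal 0             = 0ℝ
  jacobsthal 1             = 1ℝ
  jacobsthal (suc (suc n)) =
    coefficient (parity (suc (suc n))) * jacobsthal (suc n) + 2ℝ * jacobsthal n

{-# OPTIONS --safe #-}
-- Write r = b/a.  Clearing subtractions, the second identity reads
--   j (n - 1) * j (n + 1) ≈ 2 ^ (n - 1) + r * j n ^ 2              (n even),
--   j n ^ 2               ≈ 2 ^ (n - 1) + r * j (n - 1) * j (n + 1)  (n odd).
-- Since r * a ≈ b, the recurrence turns each of these into the other at n + 1.
-- The first identity is the second one multiplied by 2 * r ^ ε n.
module Submission where

open import Defs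
open import Data.Nat.Base as ℕ using (ℕ; suc; NonZero; parity)
open import Data.Product.Base using (_×_; _,_)
open import Data.Parity.Base using (Parity; 0ℙ; 1ℙ; _⁻¹)
open import Data.Parity.Properties using (suc-homo-⁻¹)
import Relation.Binary.PropositionalEquality.Core as ≡ using (subst; sym)
open import Algebra.Bundles using (CommutativeRing)
import Algebra.Properties.Ring as RingProperties
import Algebra.Properties.Semiring.Exp as Exp
import Algebra.Solver.Ring.NaturalCoefficients.Default as SemiringSolver
import Relation.Binary.Reasoning.Setoid as SetoidReasoning

-- The argument is pure ring algebra: division enters only through an element `r` with
-- `r ⊛ k 0ℙ ≋ k 1ℙ`.
module Cassini {c ℓ} (R : CommutativeRing c ℓ) where

  open CommutativeRing R
    renaming (_+_ to _⊕_; _*_ to _⊛_; -_ to ⊖_; _-_ to _⊝_; _≈_ to _≋_)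
  open Exp semiring using () renaming (_^_ to _↑_)
  open RingProperties ring using (-‿distribˡ-*; -‿distribʳ-*; ⁻¹-anti-homo-//; xyx⁻¹≈y)
  open SemiringSolver commutativeSemiring using (solve; con; _:=_; _:+_; _:*_)
  open SetoidReasoning setoid

  -- `x`, `y`, `z` stand for three consecutive terms, `P` for the power of 2, and the parity is that
  -- of the index of `y`. Being free of subtraction, both cases are within reach of a semiring
  -- solver.
  Identity : Parity → (r P x y z : Carrier) → Set ℓ
  Identity 0ℙ r P x y z = x ⊛ z ≋ P ⊕ r ⊛ (y ⊛ y)
  Identity 1ℙ r P x y z = y ⊛ y ≋ P ⊕ r ⊛ (x ⊛ z)

  -- Expand the one recurrence whose coefficient is `k 1ℙ` and rewrite that coefficient as
  -- `r ⊛ k 0ℙ`. After `id` is applied to the term with factor `t`, everything but `t ⊛ P` has a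
  -- factor `r`, and the cofactor refolds by the other recurrence, whose coefficient is `k 0ℙ`.
  identity-step : ∀ p (k : Parity → Carrier) r t P x y z w → r ⊛ k 0ℙ ≋ k 1ℙ →
                  z ≋ k (p ⁻¹) ⊛ y ⊕ t ⊛ x → w ≋ k p ⊛ z ⊕ t ⊛ y →
                  Identity p r P x y z → Identity (p ⁻¹) r (t ⊛ P) y z w
  identity-step 0ℙ k r t P x y z w rk z≋ w≋ id = begin
    z ⊛ z                                          ≈⟨ *-congʳ z≋ ⟩
    (k 1ℙ ⊛ y ⊕ t ⊛ x) ⊛ z                         ≈⟨ *-congʳ (+-congʳ (*-congʳ rk)) ⟨
    (r ⊛ k 0ℙ ⊛ y ⊕ t ⊛ x) ⊛ z                     ≈⟨ solve 6 (λ r k t x y z →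
      (r :* k :* y :+ t :* x) :* z := r :* k :* y :* z :+ t :* (x :* z)) refl r (k 0ℙ) t x y z ⟩
    r ⊛ k 0ℙ ⊛ y ⊛ z ⊕ t ⊛ (x ⊛ z)                 ≈⟨ +-congˡ (*-congˡ id) ⟩
    r ⊛ k 0ℙ ⊛ y ⊛ z ⊕ t ⊛ (P ⊕ r ⊛ (y ⊛ y))       ≈⟨ solve 6 (λ r k t P y z →
      r :* k :* y :* z :+ t :* (P :+ r :* (y :* y)) :=
      t :* P :+ r :* (y :* (k :* z :+ t :* y))) refl r (k 0ℙ) t P y z ⟩
    t ⊛ P ⊕ r ⊛ (y ⊛ (k 0ℙ ⊛ z ⊕ t ⊛ y))           ≈⟨ +-congˡ (*-congˡ (*-congˡ w≋)) ⟨
    t ⊛ P ⊕ r ⊛ (y ⊛ w)                            ∎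
  identity-step 1ℙ k r t P x y z w rk z≋ w≋ id = begin
    y ⊛ w                                          ≈⟨ *-congˡ w≋ ⟩
    y ⊛ (k 1ℙ ⊛ z ⊕ t ⊛ y)                         ≈⟨ *-congˡ (+-congʳ (*-congʳ rk)) ⟨
    y ⊛ (r ⊛ k 0ℙ ⊛ z ⊕ t ⊛ y)                     ≈⟨ solve 5 (λ r k t y z →
      y :* (r :* k :* z :+ t :* y) := r :* k :* y :* z :+ t :* (y :* y)) refl r (k 0ℙ) t y z ⟩
    r ⊛ k 0ℙ ⊛ y ⊛ z ⊕ t ⊛ (y ⊛ y)                 ≈⟨ +-congˡ (*-congˡ id) ⟩
    r ⊛ k 0ℙ ⊛ y ⊛ z ⊕ t ⊛ (P ⊕ r ⊛ (x ⊛ z))       ≈⟨ solve 7 (λ r k t P x y z →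
      r :* k :* y :* z :+ t :* (P :+ r :* (x :* z)) :=
      t :* P :+ r :* ((k :* y :+ t :* x) :* z)) refl r (k 0ℙ) t P x y z ⟩
    t ⊛ P ⊕ r ⊛ ((k 0ℙ ⊛ y ⊕ t ⊛ x) ⊛ z)           ≈⟨ +-congˡ (*-congˡ (*-congʳ z≋)) ⟨
    t ⊛ P ⊕ r ⊛ (z ⊛ z)                            ∎

  difference⁺ : ∀ u v w → u ≋ w ⊕ v → u ⊝ v ≋ w
  difference⁺ u v w u≋w+v = begin
    u ⊝ v        ≈⟨ +-congʳ (trans u≋w+v (+-comm w v)) ⟩
    v ⊕ w ⊝ v    ≈⟨ xyx⁻¹≈y v w ⟩
    w            ∎

  difference⁻ : ∀ u v w → v ≋ w ⊕ u → u ⊝ v ≋ ⊖ w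
  difference⁻ u v w v≋w+u = begin
    u ⊝ v        ≈⟨ ⁻¹-anti-homo-// v u ⟨
    ⊖ (v ⊝ u)    ≈⟨ -‿cong (difference⁺ v u w v≋w+u) ⟩
    ⊖ w          ∎

  -- `Identity` is multiplied by `t` in the even case and by `t ⊛ r` in the odd one, where the sign
  -- of the reversed difference is then absorbed into `⊖ r`.
  identity⇒unreduced : ∀ p r t P x y z → Identity p r P x y z →
    t ⊛ r ↑ (2 ℕ.* bit p) ⊛ x ⊛ z ⊝ t ⊛ r ⊛ y ↑ 2 ≋ t ⊛ P ⊛ (⊖ r) ↑ bit p
  identity⇒unreduced 0ℙ r t P x y z id = difference⁺ _ _ _ (begin
    -- Powers unfold to right-nested products ending in `1#`: `r ↑ 0` is `1#` and `y ↑ 2` is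
    -- `y ⊛ (y ⊛ 1#)`. The factors `con 1` mirror this.
    t ⊛ 1# ⊛ x ⊛ z                           ≈⟨ solve 3 (λ t x z →
      t :* con 1 :* x :* z := t :* (x :* z)) refl t x z ⟩
    t ⊛ (x ⊛ z)                              ≈⟨ *-congˡ id ⟩
    t ⊛ (P ⊕ r ⊛ (y ⊛ y))                    ≈⟨ solve 4 (λ r t P y →
      t :* (P :+ r :* (y :* y)) :=
      t :* P :* con 1 :+ t :* r :* (y :* (y :* con 1))) refl r t P y ⟩
    t ⊛ P ⊛ 1# ⊕ t ⊛ r ⊛ y ↑ 2               ∎)
  identity⇒unreduced 1ℙ r t P x y z id = begin
    t ⊛ r ↑ 2 ⊛ x ⊛ z ⊝ t ⊛ r ⊛ y ↑ 2        ≈⟨ difference⁻ _ _ (t ⊛ P ⊛ r) (begin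
      t ⊛ r ⊛ y ↑ 2                            ≈⟨ solve 3 (λ r t y →
        t :* r :* (y :* (y :* con 1)) := t :* r :* (y :* y)) refl r t y ⟩
      t ⊛ r ⊛ (y ⊛ y)                          ≈⟨ *-congˡ id ⟩
      t ⊛ r ⊛ (P ⊕ r ⊛ (x ⊛ z))                ≈⟨ solve 5 (λ r t P x z →
        t :* r :* (P :+ r :* (x :* z)) :=
        t :* P :* r :+ t :* (r :* (r :* con 1)) :* x :* z) refl r t P x z ⟩
      t ⊛ P ⊛ r ⊕ t ⊛ r ↑ 2 ⊛ x ⊛ z            ∎) ⟩
    ⊖ (t ⊛ P ⊛ r)                            ≈⟨ -‿distribʳ-* (t ⊛ P) r ⟩
    t ⊛ P ⊛ ⊖ r                              ≈⟨ *-congˡ (*-identityʳ (⊖ r)) ⟨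
    t ⊛ P ⊛ (⊖ r) ↑ 1                        ∎

  -- The exponents `bit p` and `1 ∸ bit p` put `r` on exactly the product that carries it in
  -- `Identity`, so only units and a sign remain to be adjusted.
  identity⇒reduced : ∀ p r P x y z → Identity p r P x y z →
    r ↑ bit p ⊛ x ⊛ z ⊝ r ↑ (1 ℕ.∸ bit p) ⊛ y ↑ 2 ≋ (⊖ 1#) ↑ bit p ⊛ P
  identity⇒reduced 0ℙ r P x y z id = difference⁺ _ _ _ (begin
    1# ⊛ x ⊛ z                   ≈⟨ *-congʳ (*-identityˡ x) ⟩
    x ⊛ z                        ≈⟨ id ⟩
    P ⊕ r ⊛ (y ⊛ y)              ≈⟨ solve 3 (λ r P y →
      P :+ r :* (y :* y) :=
      con 1 :* P :+ (r :* con 1) :* (y :* (y :* con 1))) refl r P y ⟩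
    1# ⊛ P ⊕ r ↑ 1 ⊛ y ↑ 2       ∎)
  identity⇒reduced 1ℙ r P x y z id = begin
    r ↑ 1 ⊛ x ⊛ z ⊝ 1# ⊛ y ↑ 2   ≈⟨ difference⁻ _ _ P (begin
      1# ⊛ y ↑ 2                   ≈⟨ solve 1 (λ y →
        con 1 :* (y :* (y :* con 1)) := y :* y) refl y ⟩
      y ⊛ y                        ≈⟨ id ⟩
      P ⊕ r ⊛ (x ⊛ z)              ≈⟨ solve 4 (λ r P x z →
        P :+ r :* (x :* z) := P :+ r :* con 1 :* x :* z) refl r P x z ⟩
      P ⊕ r ↑ 1 ⊛ x ⊛ z            ∎) ⟩
    ⊖ P                          ≈⟨ -‿cong (*-identityˡ P) ⟨
    ⊖ (1# ⊛ P)                   ≈⟨ -‿distribˡ-* 1# P ⟩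
    ⊖ 1# ⊛ P                     ≈⟨ *-congʳ (*-identityʳ (⊖ 1#)) ⟨
    (⊖ 1#) ↑ 1 ⊛ P               ∎

  -- The case with `y` of index 1: the initial term 0 kills the product with `z`, and the power of 2
  -- is `1#`.
  identity-base : ∀ r y z → y ≋ 1# → Identity 1ℙ r 1# 0# y z
  identity-base r y z y≋1 = begin
    y ⊛ y                   ≈⟨ *-cong y≋1 y≋1 ⟩
    1# ⊛ 1#                 ≈⟨ solve 2 (λ r z →
      con 1 :* con 1 := con 1 :+ r :* (con 0 :* z)) refl r z ⟩
    1# ⊕ r ⊛ (0# ⊛ z)       ∎

open CommutativeRing ℝ-commutativeRing using (setoid; *-assoc; *-comm; *-congˡ; *-identityʳ)
  renaming (refl to ≈-refl)
open Cassini ℝ-commutativeRing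

/-* : ∀ a b (a#0 : a # 0ℝ) → b / a ⟨ a#0 ⟩ * a ≈ b
/-* a b a#0 = begin
  b * a⁻¹ * a      ≈⟨ *-assoc b a⁻¹ a ⟩
  b * (a⁻¹ * a)    ≈⟨ *-congˡ {b} (*-comm a⁻¹ a) ⟩
  b * (a * a⁻¹)    ≈⟨ *-congˡ {b} (inverseʳ a a#0) ⟩
  b * 1ℝ           ≈⟨ *-identityʳ b ⟩
  b                ∎
  where
  open SetoidReasoning setoid
  a⁻¹ : ℝ
  a⁻¹ = inverse a a#0

-- Centring at `suc n` avoids truncated subtraction in the induction.
jacobsthal-identity : ∀ a b r → r * a ≈ b → ∀ n → let j = jacobsthal a b in
  Identity (parity (suc n)) r (2ℝ ^ n) (j n) (j (suc n)) (j (suc (suc n)))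
jacobsthal-identity a b r ra≈b 0 = identity-base r 1ℝ (jacobsthal a b 2) (≈-refl {1ℝ})
jacobsthal-identity a b r ra≈b (suc n) =
  -- `parity (suc (suc n))` reduces to `parity n`, whereas the step yields `parity (suc n) ⁻¹`;
  -- `suc-homo-⁻¹` identifies the two, here and in the recurrence for `j (suc (suc n))`.
  ≡.subst (λ p → Identity p r (2ℝ ^ suc n) (j (suc n)) (j (suc (suc n))) (j (suc (suc (suc n)))))
    (suc-homo-⁻¹ n)
    (identity-step (parity (suc n)) (coefficient a b) r 2ℝ (2ℝ ^ n)
      (j n) (j (suc n)) (j (suc (suc n))) (j (suc (suc (suc n)))) ra≈b
      (≡.subst (λ p → j (suc (suc n)) ≈ coefficient a b p * j (suc n) + 2ℝ * j n)
        (≡.sym (suc-homo-⁻¹ n)) (≈-refl {j (suc (suc n))}))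
      (≈-refl {j (suc (suc (suc n)))})
      (jacobsthal-identity a b r ra≈b n))
  where
  j : ℕ → ℝ
  j = jacobsthal a b

theorem6 : (a b : ℝ) (a#0 : a # 0ℝ) (b#0 : b # 0ℝ) (n : ℕ) .{{_ : NonZero n}} →
  let j   = jacobsthal a b
      b/a = b / a ⟨ a#0 ⟩
  in
  (2ℝ * b/a ^ (2 ℕ.* ε n) * j (n ℕ.∸ 1) * j (suc n) - 2ℝ * b/a * j n ^ 2
     ≈ 2ℝ ^ n * (- b/a) ^ ε n)
  ×
  (b/a ^ ε n * j (n ℕ.∸ 1) * j (suc n) - b/a ^ (1 ℕ.∸ ε n) * j n ^ 2
     ≈ (- 1ℝ) ^ ε n * 2ℝ ^ (n ℕ.∸ 1))
theorem6 a b a#0 b#0 (suc n) =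
    -- Taking `t` to be `2ℝ` makes `t ⊛ P` the unfolding of `2ℝ ^ suc n`.
    identity⇒unreduced p r 2ℝ (2ℝ ^ n) (j n) (j (suc n)) (j (suc (suc n))) identity
  , identity⇒reduced p r (2ℝ ^ n) (j n) (j (suc n)) (j (suc (suc n))) identity
  where
  j : ℕ → ℝ
  j = jacobsthal a b
  p : Parity
  p = parity (suc n)
  r : ℝ
  r = b / a ⟨ a#0 ⟩
  identity : Identity p r (2ℝ ^ n) (j n) (j (suc n)) (j (suc (suc n)))
  identity = jacobsthal-identity a b r (/-* a b a#0) n
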